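{- For any Boolean function $f(x_1,\ldots,x_n)$ represented in conjunctive normal form, the following is true: there is a Boolean tuple $(\sigma_1,\ldots,\sigma_n)\in\{0,1\}^n$ such that $f(\sigma_1,\ldots,\sigma_n)=1$ if and only if there is a special covering for the set $S(f)$ under the decomposition $d_nS(f)$.
   Context: CNF conventions. A Boolean function $f(x_1,\ldots,x_n)$ of $n$ variables represented in conjunctive normal form (CNF) with $m$ clauses is given as $f=\bigwedge_{i=1}^m c_i$, where each clause has the form $c_i=x_{j_1}^{\alpha_1}\vee\cdots\vee x_{j_k}^{\alpha_k}$ with $k\in\{1,\ldots,n\}$, $\{j_1,\ldots,j_k\}\subseteq\{1,\ldots,n\}$, $\alpha_r\in\{0,1\}$, $x_j^0=\bar x_j$, $x_j^1=x_j$. Standing assumptions: no clause contains both a variable and its negation; for every $j\in\{1,\ldots,n\}$ a literal $x_j^{\alpha}$ appears in some clause for some $\alpha\in\{0,1\}$. Clauses are numbered and each clause is identified with its number, so $S(f)=\{c_1,\ldots,c_m\}$ is an ordered set of $m$ elements. Special decomposition. For a nonempty set $S$, an ordered set $d_nS=\{(M_1^0,M_1^1),\ldots,(M_n^0,M_n^1)\}$ of ordered pairs of subsets of $S$ is a special decomposition of $S$ if (1) $M_i^0\cap M_i^1=\emptyset$ for all $i$; (2) for all $i$, $M_i^0\neq\emptyset$ or $M_i^1\neq\emptyset$; (3) $\bigcup_{i=1}^n(M_i^0\cup M_i^1)=S$. Special covering. For a special decomposition $d_nS$ and $(\alpha_1,\ldots,\alpha_n)\in\{0,1\}^n$, the ordered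 set $\{M_1^{\alpha_1},\ldots,M_n^{\alpha_n}\}$ is a special covering for $S$ under $d_nS$ if $\bigcup_{i=1}^n M_i^{\alpha_i}=S$. Decomposition generated by $f$. $F_i^0=\{c_j\in S(f): c_j\text{ contains the literal }\bar x_i\}$, $F_i^1=\{c_j\in S(f): c_j\text{ contains the literal }x_i\}$ and $d_nS(f)=\{(F_1^0,F_1^1),\ldots,(F_n^0,F_n^1)\}$. -}

module Defs where

open import Data.Bool using (Bool; true; false; not; _∧_; _∨_)
open import Data.Fin using (Fin; zero)
open import Data.Nat using (ℕ; suc; _≤_; s≤s; NonZero)
open import Data.Product using (_×_; _,_; ∃; ∃₂)
open import Data.Sum using (_⊎_; inj₁; inj₂)
open import Data.Vec using (Vec; _∷_; lookup; map; foldr′)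
open import Data.Vec.Membership.Propositional using (_∈_)
open import Data.Vec.Relation.Unary.Any using (here)
open import Level using (0ℓ)
open import Relation.Binary.PropositionalEquality using (refl)
open import Relation.Nullary using (¬_)
open import Relation.Unary using (Pred; _∩_; _∪_; ∅; U; _≐_; ⋃; Satisfiable)

-- x j ^ true is the variable x_j, and x j ^ false is its negation.
record Literal (n : ℕ) : Set where
  constructor x_^_
  field
    var  : Fin n
    sign : Bool

-- The length bounds are those of a disjunction of k literals, 1 ≤ k ≤ n.  A
-- literal may be repeated; complementary literals are excluded in CNF below.
record Clause (n : ℕ) : Set where
  field
    k        : ℕ
    1≤k      : 1 ≤ k
    k≤n      : k ≤ n
    literals : Vec (Literal n) k

open Clause public using (literals)

_contains_ : ∀ {n} → Clause n → Literal n → Set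
c contains l = l ∈ literals c

-- Clauses are identified with their positions, so the set S(f) is Fin m.
record CNF (n m : ℕ) : Set where
  field
    clauses      : Vec (Clause n) m
    noClash      : ∀ (j : Fin m) (i : Fin n) →
                   ¬ (lookup clauses j contains (x i ^ false) ×
                      lookup clauses j contains (x i ^ true))
    everyVarUsed : ∀ (i : Fin n) → ∃₂ λ (α : Bool) (j : Fin m) →
                   lookup clauses j contains (x i ^ α)

open CNF public

S : ∀ {n m} → CNF n m → Set
S {m = m} _ = Fin m

evalLiteral : ∀ {n} → Vec Bool n → Literal n → Bool
evalLiteral σ (x j ^ false) = not (lookup σ j)
evalLiteral σ (x j ^ true)  = lookup σ j

evalClause : ∀ {n} → Vec Bool n → Clause n → Bool
evalClause σ c = foldr′ _∨_ false (map (evalLiteral σ) (literals c))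

⟦_⟧ : ∀ {n m} → CNF n m → Vec Bool n → Bool
⟦ f ⟧ σ = foldr′ _∧_ true (map (evalClause σ) (clauses f))

-- M i false and M i true are M_i^0 and M_i^1.
record SpecialDecomposition (n : ℕ) (A : Set) : Set₁ where
  field
    M         : Fin n → Bool → Pred A 0ℓ
    inhabited : A
    disjoint  : ∀ i → (M i false ∩ M i true) ≐ ∅
    nonempty  : ∀ i → Satisfiable (M i false) ⊎ Satisfiable (M i true)
    exhausts  : ⋃ (Fin n) (λ i → M i false ∪ M i true) ≐ U

record SpecialCovering {n : ℕ} {A : Set} (D : SpecialDecomposition n A) : Set where
  open SpecialDecomposition D
  field
    α      : Vec Bool n
    covers : ⋃ (Fin n) (λ i → M i (lookup α i)) ≐ U

F : ∀ {n m} (f : CNF n m) → Fin n → Bool → Pred (S f) 0ℓ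
F f i α j = lookup (clauses f) j contains (x i ^ α)

private
  someClause : ∀ {n m} .{{_ : NonZero n}} (f : CNF n m) → S f
  someClause {suc n} f with everyVarUsed f zero
  ... | _ , j , _ = j

  F-nonempty : ∀ {n m} (f : CNF n m) (i : Fin n) →
               Satisfiable (F f i false) ⊎ Satisfiable (F f i true)
  F-nonempty f i with everyVarUsed f i
  ... | false , j , p = inj₁ (j , p)
  ... | true  , j , p = inj₂ (j , p)

  someLiteral : ∀ {n} (c : Clause n) → ∃ λ i →
                c contains (x i ^ false) ⊎ c contains (x i ^ true)
  someLiteral record { 1≤k = s≤s _ ; literals = (x i ^ false) ∷ _ } = i , inj₁ (here refl)
  someLiteral record { 1≤k = s≤s _ ; literals = (x i ^ true)  ∷ _ } = i , inj₂ (here refl)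

generatedDecomposition : ∀ {n m} .{{_ : NonZero n}} (f : CNF n m) →
                         SpecialDecomposition n (S f)
generatedDecomposition f = record
  { M         = F f
  ; inhabited = someClause f
  ; disjoint  = λ i → (λ {j} → noClash f j i) , λ ()
  ; nonempty  = F-nonempty f
  ; exhausts  = (λ _ → _) , λ {j} _ → someLiteral (lookup (clauses f) j)
  }

{-# OPTIONS --safe #-}
-- The satisfying tuples σ are exactly the index tuples α of the coverings:
-- a clause is true under σ iff it contains some literal x i ^ σ_i, that is,
-- iff it lies in some F_i^{σ_i}.

module Submission where

open import Defs
open import Data.Bool using (Bool; true; false; _∧_; _∨_)
open import Data.Fin using (zero; suc)
open import Data.Nat using (ℕ; NonZero)
open import Data.Product using (∃; _,_; proj₂)
open import Data.Vec using (Vec; []; _∷_; lookup; map; foldr′)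
open import Data.Vec.Membership.Propositional using (find; lose)
open import Data.Vec.Relation.Unary.Any using (Any; here; there)
open import Function.Bundles using (_⇔_; mk⇔; module Equivalence)
open import Relation.Binary.PropositionalEquality using (_≡_; refl)

open Equivalence using (to; from)

-- Evaluation unfolds into quantifiers: the conjunction is a "for all clauses" (`foldr-∧≡true⇔∀`)
-- and each disjunction a "some literal" (`foldr-∨≡true⇔Any`). By `evalLiteral-true` a true literal
-- on variable i has sign σ_i, so `evalClause-true` turns truth of a clause into membership in the
-- union of the F_i^{σ_i}. Quantified over all clauses, this is the covering condition, with the
-- same tuple on both sides.

foldr-∨≡true⇔Any : ∀ {a} {A : Set a} (p : A → Bool) {n} (xs : Vec A n) →
  foldr′ _∨_ false (map p xs) ≡ true ⇔ Any (λ y → p y ≡ true) xs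
foldr-∨≡true⇔Any p xs = mk⇔ (toAny xs) fromAny
  where
  toAny : ∀ {n} (ys : Vec _ n) → foldr′ _∨_ false (map p ys) ≡ true → Any (λ y → p y ≡ true) ys
  toAny (y ∷ ys) eq with p y in py
  ... | true  = here py
  ... | false = there (toAny ys eq)

  fromAny : ∀ {n} {ys : Vec _ n} → Any (λ y → p y ≡ true) ys → foldr′ _∨_ false (map p ys) ≡ true
  fromAny (here py) rewrite py = refl
  fromAny {ys = y ∷ _} (there any) with p y
  ... | true  = refl
  ... | false = fromAny any

foldr-∧≡true⇔∀ : ∀ {a} {A : Set a} (p : A → Bool) {n} (xs : Vec A n) →
  foldr′ _∧_ true (map p xs) ≡ true ⇔ (∀ j → p (lookup xs j) ≡ true)
foldr-∧≡true⇔∀ p xs = mk⇔ (to∀ xs) (from∀ xs)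
  where
  to∀ : ∀ {n} (ys : Vec _ n) → foldr′ _∧_ true (map p ys) ≡ true → ∀ j → p (lookup ys j) ≡ true
  -- If `p y` were `false`, `eq` would read `false ≡ true`, so only `true` remains.
  to∀ (y ∷ ys) eq j with p y in py
  to∀ (y ∷ ys) eq zero    | true = py
  to∀ (y ∷ ys) eq (suc j) | true = to∀ ys eq j

  from∀ : ∀ {n} (ys : Vec _ n) → (∀ j → p (lookup ys j) ≡ true) → foldr′ _∧_ true (map p ys) ≡ true
  from∀ []       _   = refl
  from∀ (y ∷ ys) all rewrite all zero = from∀ ys (λ j → all (suc j))

evalLiteral-true : ∀ {n} (σ : Vec Bool n) i α →
  evalLiteral σ (x i ^ α) ≡ true ⇔ lookup σ i ≡ α
evalLiteral-true σ i α with lookup σ i in eq | α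
-- `evalLiteral` exposes `lookup σ i` only once `α` is known, too late for the `with`; `eq` replaces
-- that occurrence.
... | true  | true  rewrite eq = mk⇔ (λ _ → refl) (λ _ → refl)
... | false | false rewrite eq = mk⇔ (λ _ → refl) (λ _ → refl)
... | true  | false rewrite eq = mk⇔ (λ ()) (λ ())
... | false | true  rewrite eq = mk⇔ (λ ()) (λ ())

evalClause-true : ∀ {n} (σ : Vec Bool n) (c : Clause n) →
  evalClause σ c ≡ true ⇔ ∃ λ i → c contains (x i ^ lookup σ i)
evalClause-true σ c = mk⇔ toLiteral fromLiteral
  where
  clause⇔Any = foldr-∨≡true⇔Any (evalLiteral σ) (literals c)

  toLiteral : evalClause σ c ≡ true → ∃ λ i → c contains (x i ^ lookup σ i)
  toLiteral eq with find (to clause⇔Any eq)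
  ... | (x i ^ α) , l∈c , holds with to (evalLiteral-true σ i α) holds
  -- Truth of the literal forces its sign `α` to be `lookup σ i`.
  ... | refl = i , l∈c

  fromLiteral : (∃ λ i → c contains (x i ^ lookup σ i)) → evalClause σ c ≡ true
  fromLiteral (i , l∈c) =
    from clause⇔Any (lose l∈c (from (evalLiteral-true σ i (lookup σ i)) refl))

theorem2p3 : ∀ {n m : ℕ} .{{_ : NonZero n}} (f : CNF n m) →
    (∃ λ (σ : Vec Bool n) → ⟦ f ⟧ σ ≡ true) ⇔ SpecialCovering (generatedDecomposition f)
theorem2p3 f = mk⇔
  (λ (σ , sat) → record
    { α      = σ
    -- Inclusion in `U` is trivial; the converse asks, for each clause `j`, for an `i` with `j` in
    -- `F f i (lookup σ i)`.
    ; covers = (λ _ → _) , λ {j} _ →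
        to (evalClause-true σ (lookup (clauses f) j)) (to (sat⇔∀ σ) sat j)
    })
  (λ cover → let open SpecialCovering cover in
    α , from (sat⇔∀ α) λ j →
      from (evalClause-true α (lookup (clauses f) j)) (proj₂ covers _))
  where
  sat⇔∀ = λ σ → foldr-∧≡true⇔∀ (evalClause σ) (clauses f)
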